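{- For every positive integer $k$ and every finite simple graph $G$, either $G$ contains no induced path on $k$ vertices, or $G$ contains an avoidable induced path on $k$ vertices.
   Context: Graphs are finite, simple and loopless. An induced path on $k$ vertices is called a $P_k$. Given an induced path $P$ in $G$, an extension of $P$ is an induced path $xPy$ in $G$, i.e. an induced path obtained from $P$ by adding a vertex $x$ adjacent to one endpoint of $P$ and a vertex $y$ adjacent to the other endpoint (the whole being an induced path). An induced path $P$ is failing if no induced cycle of $G$ contains $P$. A path $P$ in $G$ is avoidable if it is induced and has no failing extension (i.e. every extension of $P$ is contained in some induced cycle of $G$). -}

module Defs where

open import Data.Nat using (ℕ; zero; suc; _≤_)
open import Data.Bool using (Bool; true; false)
open import Data.Fin using (Fin; toℕ)
open import Data.List using (List; []; _∷_; _++_; [_]; length; lookup)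
open import Data.List.Relation.Unary.All using (All)
open import Data.List.Relation.Unary.Unique.Propositional using (Unique)
open import Data.List.Membership.Propositional using (_∈_)
open import Data.Product using (Σ; ∃; _×_)
open import Data.Sum using (_⊎_)
open import Function.Bundles using (_⇔_)
open import Relation.Binary.PropositionalEquality using (_≡_)
open import Relation.Nullary using (¬_)

record Graph : Set where
  field
    n      : ℕ
    adj    : Fin n → Fin n → Bool
    sym    : ∀ u v → adj u v ≡ adj v u
    irrefl : ∀ v → adj v v ≡ false

module _ (G : Graph) where
  open Graph G

  Vertex : Set
  Vertex = Fin n

  Edge : Vertex → Vertex → Set
  Edge u v = adj u v ≡ true

  PathAdj : ℕ → ℕ → Set
  PathAdj a b = suc a ≡ b ⊎ suc b ≡ a

  CycAdj : ℕ → ℕ → ℕ → Set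
  CycAdj m a b = suc a ≡ b ⊎ suc b ≡ a ⊎ (a ≡ 0 × suc b ≡ m) ⊎ (b ≡ 0 × suc a ≡ m)

  IsInducedPath : List Vertex → Set
  IsInducedPath ps =
    Unique ps ×
    (∀ (i j : Fin (length ps)) →
       Edge (lookup ps i) (lookup ps j) ⇔ PathAdj (toℕ i) (toℕ j))

  IsInducedCycle : List Vertex → Set
  IsInducedCycle cs =
    3 ≤ length cs ×
    Unique cs ×
    (∀ (i j : Fin (length cs)) →
       Edge (lookup cs i) (lookup cs j) ⇔ CycAdj (length cs) (toℕ i) (toℕ j))

  -- the induced cycle cs contains the path ps (every vertex of ps lies on cs;
  -- since both are induced, this is the same as subgraph containment)
  CycleContains : List Vertex → List Vertex → Set
  CycleContains cs ps = All (_∈ cs) ps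

  InSomeInducedCycle : List Vertex → Set
  InSomeInducedCycle ps = ∃ λ cs → IsInducedCycle cs × CycleContains cs ps

  Failing : List Vertex → Set
  Failing ps = IsInducedPath ps × ¬ InSomeInducedCycle ps

  IsExtension : List Vertex → Vertex → Vertex → Set
  IsExtension ps x y = IsInducedPath (x ∷ ps ++ [ y ])

  Avoidable : List Vertex → Set
  Avoidable ps =
    IsInducedPath ps ×
    (∀ x y → IsExtension ps x y → InSomeInducedCycle (x ∷ ps ++ [ y ]))

{-# OPTIONS --safe #-}
module Submission where

-- Inside a vertex set A, let U ⊆ A be connected such that A ∖ N[U] still contains an induced Pₖ,
-- and suppose that U cannot be enlarged by a vertex of A next to U.
-- By induction on A there is an induced Pₖ, say Q, that is avoidable in A ∖ N[U], and Q is then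
-- avoidable in A.  Indeed let xQy be an extension in A.  If neither x nor y lies in N(U), use the
-- induction hypothesis.  If both do, an induced path from y to x through U closes xQy to an induced
-- cycle.  If only x does, then Q minus its first vertex plus y is an induced Pₖ in A ∖ N[U ∪ {x}],
-- against the maximality of U; likewise for y.
-- If A ∖ N[u] contains no Pₖ for any u ∈ A, the same shift shows that no Pₖ has an extension.

open import Defs
open import Data.Nat using (ℕ; zero; suc; _≤_; z≤n; s≤s)
open import Data.Nat.Properties using (suc-injective; +-comm)
open import Data.Bool using (true)
import Data.Bool.Properties as Bool
open import Data.Fin using (Fin; toℕ) renaming (zero to fzero; suc to fsuc)
open import Data.Fin.Properties using (any?; _≟_)
open import Data.Fin.Subset using (Subset; ⊤; ⁅_⁆; _∪_; _⊂_; _⊃_; _⊆_)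
  renaming (_∈_ to _∈ₛ_; _∉_ to _∉ₛ_)
open import Data.Fin.Subset.Induction using (⊂-wellFounded; ⊃-wellFounded)
open import Data.Fin.Subset.Properties
  using (_∈?_; ∈⊤; x∈⁅x⁆; x∈⁅y⁆⇒x≡y; x∈p∪q⁻; p⊆p∪q; q⊆p∪q)
open import Data.List using (List; []; _∷_; _++_; [_]; length; lookup; initLast; _∷ʳ′_)
open import Data.List.Properties using (length-++; ++-assoc)
open import Data.List.Relation.Unary.All as All using (All; []; _∷_)
open import Data.List.Relation.Unary.All.Properties using (++⁺; ++⁻ˡ; ++⁻ʳ; ¬Any⇒All¬)
open import Data.List.Relation.Unary.Unique.Propositional using (Unique)
open import Data.List.Relation.Unary.AllPairs using ([]; _∷_)
open import Data.List.Relation.Unary.Any as Any using (Any; here; there; index)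
open import Data.List.Relation.Unary.Any.Properties as Anyₚ using (lookup-index)
open import Data.List.Membership.Propositional using (_∈_)
open import Data.List.Membership.Propositional.Properties using (∈-++⁺ˡ; ∈-++⁺ʳ; ∈-lookup)
open import Data.Product using (∃; _×_; _,_; proj₁; proj₂)
open import Data.Sum using (_⊎_; inj₁; inj₂; swap)
open import Data.Vec using (tabulate)
open import Data.Vec.Properties using (lookup∘tabulate; lookup⇒[]=; []=⇒lookup)
open import Function using (_∘_)
open import Function.Bundles using (_⇔_; mk⇔; Equivalence)
open import Level using (0ℓ)
open import Induction.WellFounded using (Acc; acc)
open import Relation.Binary.Construct.Closure.ReflexiveTransitive as Star
  using (Star; ε; _◅_; _◅◅_)
open import Relation.Binary.PropositionalEquality
  using (_≡_; _≢_; refl; sym; trans; cong; subst)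
open import Relation.Nullary using (¬_; Dec; yes; no; does; contradiction)
open import Relation.Nullary.Decidable
  using (_×-dec_; _⊎-dec_; ¬?; map′; dec-true)
open import Relation.Unary using (Pred; Decidable)

open Equivalence using (to; from)

-- Subsets cut out by decidable predicates, and bounded search for lists.

module _ {n : ℕ} where

  separate : ∀ {P : Pred (Fin n) 0ℓ} → Decidable P → Subset n
  separate P? = tabulate (does ∘ P?)

  ∈-separate⁺ : ∀ {P : Pred (Fin n) 0ℓ} (P? : Decidable P) {v} → P v → v ∈ₛ separate P?
  ∈-separate⁺ P? {v} p =
    lookup⇒[]= v _ (trans (lookup∘tabulate (does ∘ P?) v) (dec-true (P? v) p))

  ∈-separate⁻ : ∀ {P : Pred (Fin n) 0ℓ} (P? : Decidable P) {v} → v ∈ₛ separate P? → P v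
  ∈-separate⁻ P? {v} v∈ with P? v | trans (sym (lookup∘tabulate (does ∘ P?) v)) ([]=⇒lookup v∈)
  ... | yes p | _  = p
  ... | no  _ | ()

  -- There are finitely many lists of a fixed length over `Fin n`, so an entry-by-entry search
  -- decides existence. This makes the case distinctions on induced Pₖ constructive.
  anyOfLength? : ∀ k {P : Pred (List (Fin n)) 0ℓ} → Decidable P →
                 Dec (∃ λ ps → length ps ≡ k × P ps)
  anyOfLength? zero    P? = map′ (λ p → [] , refl , p) (λ { ([] , _ , p) → p }) (P? [])
  anyOfLength? (suc k) P? =
    map′ (λ { (v , ps , refl , p) → v ∷ ps , refl , p })
         (λ { (v ∷ ps , refl , p) → v , ps , refl , p })
         (any? λ v → anyOfLength? k (P? ∘ (v ∷_)))

-- Adjacency, and an inductive form of induced paths.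

module _ (G : Graph) where

  private
    n = Graph.n G
    V = Vertex G

  infix 4 _~_

  _~_ : V → V → Set
  _~_ = Edge G

  ~-sym : ∀ {u v} → u ~ v → v ~ u
  ~-sym {u} {v} u~v = trans (Graph.sym G v u) u~v

  ~-irrefl : ∀ {v} → ¬ v ~ v
  ~-irrefl {v} v~v with trans (sym v~v) (Graph.irrefl G v)
  ... | ()

  edge⇒≢ : ∀ {u v} → u ~ v → u ≢ v
  edge⇒≢ e refl = ~-irrefl e

  -- This is membership of v in the closed neighbourhood N[u].
  Touch : V → V → Set
  Touch u v = u ≡ v ⊎ u ~ v

  touch? : ∀ u v → Dec (Touch u v)
  touch? u v = (u ≟ v) ⊎-dec (Graph.adj G u v Bool.≟ true)

  Touch-sym : ∀ {u v} → Touch u v → Touch v u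
  Touch-sym (inj₁ eq) = inj₁ (sym eq)
  Touch-sym (inj₂ e)  = inj₂ (~-sym e)

  Far : V → V → Set
  Far u v = ¬ Touch u v

  -- Index-free counterpart of `IsInducedPath`, suited to structural recursion. Distinctness is
  -- built in: `Far` excludes equality, and an edge has distinct ends.
  data Induced : List V → Set where
    []   : Induced []
    [-]  : ∀ {v} → Induced [ v ]
    cons : ∀ {u v ps} → u ~ v → All (Far u) ps → Induced (v ∷ ps) → Induced (u ∷ v ∷ ps)

  induced? : Decidable Induced
  induced? []           = yes []
  induced? (v ∷ [])     = yes [-]
  induced? (u ∷ v ∷ ps) =
    map′ (λ (e , f , r) → cons e f r) (λ { (cons e f r) → e , f , r })
         ((Graph.adj G u v Bool.≟ true) ×-dec All.all? (¬? ∘ touch? u) ps ×-dec induced? (v ∷ ps))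

  PathAdj-suc : ∀ {a b} → PathAdj G a b ⇔ PathAdj G (suc a) (suc b)
  PathAdj-suc = mk⇔ (λ { (inj₁ p) → inj₁ (cong suc p) ; (inj₂ p) → inj₂ (cong suc p) })
                    (λ { (inj₁ p) → inj₁ (suc-injective p) ; (inj₂ p) → inj₂ (suc-injective p) })

  isInducedPath⇒induced : ∀ ps → IsInducedPath G ps → Induced ps
  isInducedPath⇒induced []           _ = []
  isInducedPath⇒induced (v ∷ [])     _ = [-]
  isInducedPath⇒induced (u ∷ v ∷ ps) ((_ ∷ u∉ps) ∷ uniq , adj) =
    cons (from (adj fzero (fsuc fzero)) (inj₁ refl))
         (All.tabulate far)
         (isInducedPath⇒induced (v ∷ ps)
           (uniq , λ i j → mk⇔ (from PathAdj-suc ∘ to (adj (fsuc i) (fsuc j)))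
                               (from (adj (fsuc i) (fsuc j)) ∘ to PathAdj-suc)))
    where
    far : ∀ {w} → w ∈ ps → Far u w
    far w∈ (inj₁ refl) = All.lookup u∉ps w∈ refl
    -- A vertex of `ps` has position at least 2 in the whole path, so `PathAdj` rules it out as a
    -- neighbour of position 0.
    far w∈ (inj₂ e)
      with to (adj fzero (fsuc (fsuc (index w∈)))) (subst (u ~_) (lookup-index w∈) e)
    ... | inj₁ ()
    ... | inj₂ ()

  induced⇒isInducedPath : ∀ {ps} → Induced ps → IsInducedPath G ps
  induced⇒isInducedPath ind = unique ind , adjacency ind
    where
    unique : ∀ {ps} → Induced ps → Unique ps
    unique []            = []
    unique [-]           = [] ∷ []
    unique (cons e fs r) =
      (edge⇒≢ e ∷ All.map (_∘ inj₁) fs) ∷ unique r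

    head-adjacency : ∀ {u ps} → Induced (u ∷ ps) → ∀ j →
                     u ~ lookup (u ∷ ps) j ⇔ PathAdj G 0 (toℕ j)
    head-adjacency _ fzero = mk⇔ (λ e → contradiction e ~-irrefl) λ { (inj₁ ()) ; (inj₂ ()) }
    head-adjacency (cons e _ _) (fsuc fzero) = mk⇔ (λ _ → inj₁ refl) (λ _ → e)
    head-adjacency (cons {ps = ps} _ fs _) (fsuc (fsuc j)) =
      mk⇔ (λ e → contradiction (inj₂ e) (All.lookup fs (∈-lookup j)))
          λ { (inj₁ ()) ; (inj₂ ()) }

    adjacency : ∀ {ps} → Induced ps → ∀ i j →
                lookup ps i ~ lookup ps j ⇔ PathAdj G (toℕ i) (toℕ j)
    adjacency {_ ∷ _} ind  fzero    j        = head-adjacency ind j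
    adjacency {_ ∷ _} ind  (fsuc i) fzero    =
      mk⇔ (swap ∘ to (head-adjacency ind (fsuc i)) ∘ ~-sym)
          (~-sym ∘ from (head-adjacency ind (fsuc i)) ∘ swap)
    adjacency (cons _ _ r) (fsuc i) (fsuc j) =
      mk⇔ (to PathAdj-suc ∘ to (adjacency r i j)) (from (adjacency r i j) ∘ from PathAdj-suc)

  -- Closing an induced path to an induced cycle.

  data MeetsLast (u : V) : List V → Set where
    last : ∀ {v} → u ~ v → MeetsLast u [ v ]
    skip : ∀ {v ps} → Far u v → MeetsLast u ps → MeetsLast u (v ∷ ps)

  skip⁺ : ∀ {u ps qs} → All (Far u) ps → MeetsLast u qs → MeetsLast u (ps ++ qs)
  skip⁺ []       l = l
  skip⁺ (f ∷ fs) l = skip f (skip⁺ fs l)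

  meetsLast-lookup : ∀ {u ps} → MeetsLast u ps → ∀ j →
                     u ~ lookup ps j ⇔ suc (toℕ j) ≡ length ps
  meetsLast-lookup (last e)   fzero    = mk⇔ (λ _ → refl) (λ _ → e)
  -- Splitting the tail exposes a second entry, so that position 0 is visibly not the last one.
  meetsLast-lookup (skip f (last _))   fzero = mk⇔ (λ e → contradiction (inj₂ e) f) λ ()
  meetsLast-lookup (skip f (skip _ _)) fzero = mk⇔ (λ e → contradiction (inj₂ e) f) λ ()
  meetsLast-lookup (skip _ l) (fsuc j) =
    mk⇔ (cong suc ∘ to (meetsLast-lookup l j)) (from (meetsLast-lookup l j) ∘ suc-injective)

  meetsLast⇒∉ : ∀ {u ps} → MeetsLast u ps → All (u ≢_) ps
  meetsLast⇒∉ (last e)   = edge⇒≢ e ∷ []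
  meetsLast⇒∉ (skip f l) = f ∘ inj₁ ∷ meetsLast⇒∉ l

  -- The cycle is cut at u, which takes position 0: its neighbours are positions 1 and m - 1, and
  -- all other adjacencies are those of the path, shifted by one. `MeetsLast` makes `ps` nonempty,
  -- hence length at least 3.
  closeCycle : ∀ {u v ps} → u ~ v → MeetsLast u ps → Induced (v ∷ ps) →
               IsInducedCycle G (u ∷ v ∷ ps)
  closeCycle {u} {v} {ps} u~v l ind =
    long l , ((edge⇒≢ u~v ∷ meetsLast⇒∉ l) ∷ proj₁ path) , adjacency
    where
    path = induced⇒isInducedPath ind
    cyc = u ∷ v ∷ ps
    m = length cyc

    long : ∀ {qs} → MeetsLast u qs → 3 ≤ length (u ∷ v ∷ qs)
    long (last _)   = s≤s (s≤s (s≤s z≤n))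
    long (skip _ _) = s≤s (s≤s (s≤s z≤n))

    head-adjacency : ∀ j → u ~ lookup cyc j ⇔ CycAdj G m 0 (toℕ j)
    head-adjacency fzero =
      mk⇔ (λ e → contradiction e ~-irrefl)
          λ { (inj₁ ()) ; (inj₂ (inj₁ ()))
            ; (inj₂ (inj₂ (inj₁ (_ , ())))) ; (inj₂ (inj₂ (inj₂ (_ , ())))) }
    head-adjacency (fsuc fzero) = mk⇔ (λ _ → inj₁ refl) (λ _ → u~v)
    head-adjacency (fsuc (fsuc j)) =
      mk⇔ (λ e → inj₂ (inj₂ (inj₁ (refl , cong (suc ∘ suc) (to (meetsLast-lookup l j) e)))))
          λ { (inj₁ ()) ; (inj₂ (inj₁ ()))
            ; (inj₂ (inj₂ (inj₁ (_ , eq)))) →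
                from (meetsLast-lookup l j) (suc-injective (suc-injective eq))
            ; (inj₂ (inj₂ (inj₂ (() , _)))) }

    flip-adj : ∀ {a b} → CycAdj G m a b → CycAdj G m b a
    flip-adj (inj₁ p)               = inj₂ (inj₁ p)
    flip-adj (inj₂ (inj₁ p))        = inj₁ p
    flip-adj (inj₂ (inj₂ (inj₁ p))) = inj₂ (inj₂ (inj₂ p))
    flip-adj (inj₂ (inj₂ (inj₂ p))) = inj₂ (inj₂ (inj₁ p))

    -- The wrap-around cases of `CycAdj` involve position 0, so they never arise between two
    -- successors.
    inner : ∀ {a b} → PathAdj G a b ⇔ CycAdj G m (suc a) (suc b)
    inner = mk⇔ (λ { (inj₁ p) → inj₁ (cong suc p) ; (inj₂ p) → inj₂ (inj₁ (cong suc p)) })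
                λ { (inj₁ p) → inj₁ (suc-injective p)
                  ; (inj₂ (inj₁ p)) → inj₂ (suc-injective p)
                  ; (inj₂ (inj₂ (inj₁ (() , _))))
                  ; (inj₂ (inj₂ (inj₂ (() , _)))) }

    adjacency : ∀ i j → lookup cyc i ~ lookup cyc j ⇔ CycAdj G m (toℕ i) (toℕ j)
    adjacency fzero    j        = head-adjacency j
    adjacency (fsuc i) fzero    =
      mk⇔ (flip-adj ∘ to (head-adjacency (fsuc i)) ∘ ~-sym)
          (~-sym ∘ from (head-adjacency (fsuc i)) ∘ flip-adj)
    adjacency (fsuc i) (fsuc j) =
      mk⇔ (to inner ∘ to (proj₂ path i j)) (from (proj₂ path i j) ∘ from inner)

  -- Cutting, gluing and shortcutting induced paths.

  ~-head : ∀ {u v ps} → Induced (u ∷ v ∷ ps) → u ~ v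
  ~-head (cons e _ _) = e

  far-rest : ∀ {u v ps} → Induced (u ∷ v ∷ ps) → All (Far u) ps
  far-rest (cons _ fs _) = fs

  induced-tail : ∀ {v ps} → Induced (v ∷ ps) → Induced ps
  induced-tail [-]          = []
  induced-tail (cons _ _ r) = r

  induced-init : ∀ ps {v} → Induced (ps ++ [ v ]) → Induced ps
  induced-init []           _             = []
  induced-init (u ∷ [])     _             = [-]
  induced-init (u ∷ w ∷ ps) (cons e fs r) = cons e (++⁻ˡ ps fs) (induced-init (w ∷ ps) r)

  -- The view from the last vertex, mirroring `far-rest` and `~-head` without reversing the list.
  far-init : ∀ ps {u v} → Induced (ps ++ u ∷ [ v ]) → All (Far v) ps × u ~ v
  far-init []           (cons e _ _)  = [] , e
  far-init (p ∷ [])     (cons _ (f ∷ _) (cons e _ _)) = f ∘ Touch-sym ∷ [] , e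
  far-init (p ∷ q ∷ ps) (cons _ fs r) with far-init (q ∷ ps) r | ++⁻ʳ ps fs
  ... | gs , e | _ ∷ f ∷ [] = f ∘ Touch-sym ∷ gs , e

  meetsLast-init : ∀ {u} v ps → Induced (v ∷ ps ++ [ u ]) → MeetsLast u (v ∷ ps)
  meetsLast-init v []       (cons e _ _) = last (~-sym e)
  meetsLast-init v (w ∷ ps) (cons _ fs r) with ++⁻ʳ ps fs
  ... | f ∷ [] = skip (f ∘ Touch-sym) (meetsLast-init w ps r)

  -- The pairs covered by neither path are those between `ps` and `qs`; the last hypothesis handles
  -- exactly these.
  glue : ∀ {v} ps {qs} → Induced (ps ++ [ v ]) → Induced (v ∷ qs) →
         All (λ p → All (Far p) qs) ps → Induced (ps ++ v ∷ qs)
  glue []           _            r _        = r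
  glue (p ∷ [])     (cons e _ _) r (f ∷ []) = cons e f r
  glue (p ∷ q ∷ ps) (cons e fs s) r (f ∷ gs) with ++⁻ʳ ps fs
  ... | fv ∷ [] = cons e (++⁺ (++⁻ˡ ps fs) (fv ∷ f)) (glue (q ∷ ps) s r gs)

  -- From u the path jumps to the last vertex in N[u] and drops everything before it; if that vertex
  -- is u itself, the path starts there. That the inner vertices come from `ps` is expressed by
  -- preserving every predicate.
  prepend : ∀ {u x} → u ≢ x → ∀ ps → Induced (ps ++ [ x ]) → Any (Touch u) (ps ++ [ x ]) →
            ∃ λ qs → Induced (u ∷ qs ++ [ x ]) × (∀ {P : Pred V 0ℓ} → All P ps → All P qs)
  prepend u≢x []       _   (here (inj₁ eq)) = contradiction eq u≢x
  prepend u≢x []       _   (here (inj₂ e))  = [] , cons e [] [-] , λ _ → []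
  -- The tail is tested first, so that the last contact is the one chosen.
  prepend {u} {x} u≢x (p ∷ ps) ind t with Any.any? (touch? u) (ps ++ [ x ])
  ... | yes t′ with prepend u≢x ps (induced-tail ind) t′
  ...   | qs , ind′ , sub = qs , ind′ , λ { (_ ∷ a) → sub a }
  prepend u≢x (p ∷ ps) ind (there t)        | no ¬t = contradiction t ¬t
  prepend u≢x (p ∷ ps) ind (here (inj₁ refl)) | no ¬t = ps , ind , λ { (_ ∷ a) → a }
  prepend u≢x (p ∷ ps) ind (here (inj₂ e))  | no ¬t =
    p ∷ ps , cons e (¬Any⇒All¬ _ ¬t) ind , λ a → a

  -- Connected vertex sets and induced paths through them.

  Within : Subset n → V → V → Set
  Within U u v = (u ∈ₛ U × v ∈ₛ U) × u ~ v

  Within-sym : ∀ {U u v} → Within U u v → Within U v u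
  Within-sym ((u∈ , v∈) , e) = (v∈ , u∈) , ~-sym e

  -- Walks to one hub suffice: two of them join any pair, and a new vertex costs only one more edge.
  -- The hub also witnesses nonemptiness.
  Connected : Subset n → Set
  Connected U = ∃ λ h → h ∈ₛ U × (∀ {u} → u ∈ₛ U → Star (Within U) u h)

  connected-⁅⁆ : ∀ u → Connected ⁅ u ⁆
  connected-⁅⁆ u = u , x∈⁅x⁆ u , λ v∈ → subst (λ v → Star _ v u) (sym (x∈⁅y⁆⇒x≡y u v∈)) ε

  walk : ∀ {U u v} → Connected U → u ∈ₛ U → v ∈ₛ U → Star (Within U) u v
  walk (_ , _ , toHub) u∈ v∈ = toHub u∈ ◅◅ Star.reverse Within-sym (toHub v∈)

  Touches : Subset n → V → Set
  Touches U v = ∃ λ u → u ∈ₛ U × Touch u v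

  touches? : ∀ U → Decidable (Touches U)
  touches? U v = any? λ u → (u ∈? U) ×-dec touch? u v

  connected-∪ : ∀ {U v} → Connected U → v ∉ₛ U → Touches U v → Connected (U ∪ ⁅ v ⁆)
  connected-∪ _ v∉ (_ , u∈ , inj₁ refl) = contradiction u∈ v∉
  connected-∪ {U} {v} (h , h∈ , toHub) _ (u , u∈ , inj₂ u~v) = h , p⊆p∪q _ h∈ , toHub′
    where
    lift : ∀ {a} → a ∈ₛ U → Star (Within (U ∪ ⁅ v ⁆)) a h
    lift = Star.map (λ ((a∈ , b∈) , e) → (p⊆p∪q _ a∈ , p⊆p∪q _ b∈) , e) ∘ toHub

    toHub′ : ∀ {a} → a ∈ₛ U ∪ ⁅ v ⁆ → Star (Within (U ∪ ⁅ v ⁆)) a h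
    toHub′ a∈ with x∈p∪q⁻ U ⁅ v ⁆ a∈
    ... | inj₁ a∈U = lift a∈U
    ... | inj₂ a∈v with x∈⁅y⁆⇒x≡y v a∈v
    ...   | refl = ((a∈ , p⊆p∪q _ u∈) , ~-sym u~v) ◅ lift u∈

  -- The walk is processed from its far end, each earlier vertex being prepended with shortcuts; x
  -- lies outside U, so no vertex of the walk equals x.
  walk⇒induced : ∀ {U x u v} → x ∉ₛ U → u ∈ₛ U → v ∈ₛ U → Star (Within U) u v → Touch v x →
                 ∃ λ ps → Induced (u ∷ ps ++ [ x ]) × All (_∈ₛ U) ps
  walk⇒induced x∉ u∈ v∈ ε t with prepend (λ { refl → x∉ u∈ }) [] [-] (here t)
  ... | ps , ind , sub = ps , ind , sub []
  walk⇒induced x∉ u∈ v∈ (((_ , w∈) , e) ◅ es) t with walk⇒induced x∉ w∈ v∈ es t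
  ... | ps , ind , ps⊆ with prepend (λ { refl → x∉ u∈ }) (_ ∷ ps) ind (here (inj₂ e))
  ...   | qs , ind′ , sub = qs , ind′ , sub (w∈ ∷ ps⊆)

  -- A path runs from b, a contact of y, through U to x; prepending y then shortcuts any later
  -- contacts of y.
  link : ∀ {U x y} → Connected U → x ∉ₛ U → y ≢ x → Touches U x → Touches U y →
         ∃ λ ps → Induced (y ∷ ps ++ [ x ]) × All (_∈ₛ U) ps
  link conn x∉ y≢x (a , a∈ , ta) (b , b∈ , tb)
    with walk⇒induced x∉ b∈ a∈ (walk conn b∈ a∈) ta
  ... | ps , ind , ps⊆ with prepend y≢x (b ∷ ps) ind (here (Touch-sym tb))
  ...   | qs , ind′ , sub = qs , ind′ , sub (b∈ ∷ ps⊆)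

  -- Removing closed neighbourhoods, and shifting or closing extensions.

  infixl 6 _∖N[_]

  ∖N? : ∀ A U → Decidable (λ v → v ∈ₛ A × ¬ Touches U v)
  ∖N? A U v = (v ∈? A) ×-dec ¬? (touches? U v)

  _∖N[_] : Subset n → Subset n → Subset n
  A ∖N[ U ] = separate (∖N? A U)

  ∖N⁺ : ∀ {A U v} → v ∈ₛ A → ¬ Touches U v → v ∈ₛ A ∖N[ U ]
  ∖N⁺ {A} {U} v∈ ¬t = ∈-separate⁺ (∖N? A U) (v∈ , ¬t)

  ∖N⁻ : ∀ {A U v} → v ∈ₛ A ∖N[ U ] → v ∈ₛ A × ¬ Touches U v
  ∖N⁻ {A} {U} = ∈-separate⁻ (∖N? A U)

  ∖N-⁅⁆ : ∀ {A u v} → v ∈ₛ A → Far u v → v ∈ₛ A ∖N[ ⁅ u ⁆ ]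
  ∖N-⁅⁆ v∈ f = ∖N⁺ v∈ λ (w , w∈ , t) → f (subst (λ w → Touch w _) (x∈⁅y⁆⇒x≡y _ w∈) t)

  ∖N-∪ : ∀ {A U u v} → v ∈ₛ A ∖N[ U ] → Far u v → v ∈ₛ A ∖N[ U ∪ ⁅ u ⁆ ]
  ∖N-∪ {A} {U} {u} {v} v∈ f = ∖N⁺ (proj₁ (∖N⁻ v∈)) ¬t
    where
    ¬t : ¬ Touches (U ∪ ⁅ u ⁆) v
    ¬t (w , w∈ , t) with x∈p∪q⁻ U ⁅ u ⁆ w∈
    ... | inj₁ w∈U = proj₂ (∖N⁻ {A} v∈) (w , w∈U , t)
    ... | inj₂ w∈u = f (subst (λ w → Touch w v) (x∈⁅y⁆⇒x≡y u w∈u) t)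

  -- A vertex of U touches itself and so is removed; this drives the induction on A.
  ∖N-⊂ : ∀ {A U u} → u ∈ₛ A → u ∈ₛ U → A ∖N[ U ] ⊂ A
  ∖N-⊂ {A} {u = u} u∈A u∈U =
    proj₁ ∘ ∖N⁻ , u , u∈A , λ u∈ → proj₂ (∖N⁻ {A} u∈) (u , u∈U , inj₁ refl)

  -- The shift away from x: trading the first vertex of the path, the only neighbour of x, for y
  -- keeps the length and leaves N[x].
  dropFirst : ∀ {x y} ps → 1 ≤ length ps → Induced (x ∷ ps ++ [ y ]) →
              ∃ λ qs → length qs ≡ length ps × Induced qs ×
                       All (Far x) qs × All (_∈ ps ++ [ y ]) qs
  dropFirst {y = y} (p ∷ ps) _ (cons _ fs r) =
    ps ++ [ y ] , trans (length-++ ps) (+-comm (length ps) 1) , induced-tail r , fs ,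
    All.tabulate there

  -- The mirror shift, away from y, with x in exchange for the last vertex.
  dropLast : ∀ {x y} ps → 1 ≤ length ps → Induced (x ∷ ps ++ [ y ]) →
             ∃ λ qs → length qs ≡ length ps × Induced qs ×
                      All (Far y) qs × All (_∈ x ∷ ps) qs
  dropLast ps 1≤ ind with initLast ps
  dropLast {x} {y} _ _ ind | qs ∷ʳ′ q =
    x ∷ qs , sym (trans (length-++ qs) (+-comm (length qs) 1)) ,
    induced-init (x ∷ qs) (induced-init (x ∷ qs ++ [ q ]) ind) ,
    proj₁ (far-init (x ∷ qs) (subst Induced (cong (x ∷_) (++-assoc qs [ q ] [ y ])) ind)) ,
    All.tabulate λ { (here eq) → here eq ; (there v∈) → there (∈-++⁺ˡ v∈) }

  far-ends : ∀ {x y} ps → 1 ≤ length ps → Induced (x ∷ ps ++ [ y ]) → Far x y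
  far-ends (_ ∷ ps) _ ind with ++⁻ʳ ps (far-rest ind)
  ... | f ∷ [] = f

  first-edge : ∀ {x y} ps → 1 ≤ length ps → Induced (x ∷ ps ++ [ y ]) → Any (x ~_) ps
  first-edge (_ ∷ _) _ ind = here (~-head ind)

  last-edge : ∀ {x y} ps → 1 ≤ length ps → Induced (x ∷ ps ++ [ y ]) → Any (_~ y) ps
  last-edge ps 1≤ ind with initLast ps
  last-edge {x} {y} _ _ ind | qs ∷ʳ′ q =
    Anyₚ.++⁺ʳ qs (here (proj₂ (far-init (x ∷ qs)
      (subst Induced (cong (x ∷_) (++-assoc qs [ q ] [ y ])) ind))))

  -- The two paths are glued at y with x removed from both; then x closes the cycle, meeting only
  -- the first vertex of `ps` and the last of `y ∷ qs`.
  closeThrough : ∀ {x y} ps qs → 1 ≤ length ps →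
                 Induced (x ∷ ps ++ [ y ]) → Induced (y ∷ qs ++ [ x ]) →
                 All (λ p → All (Far p) qs) ps →
                 IsInducedCycle G (x ∷ ps ++ y ∷ qs)
  closeThrough {y = y} (p ∷ ps) qs _ ind ind′ apart =
    closeCycle (~-head ind)
      (skip⁺ (++⁻ˡ ps (far-rest ind)) (meetsLast-init y qs ind′))
      (glue (p ∷ ps) (induced-tail ind) (induced-init (y ∷ qs) ind′) apart)

  -- The two nested inductions, relative to a vertex set.

  module _ {k : ℕ} (1≤k : 1 ≤ k) where

    HasPath : Subset n → Set
    HasPath A = ∃ λ ps → length ps ≡ k × Induced ps × All (_∈ₛ A) ps

    hasPath? : Decidable HasPath
    hasPath? A = anyOfLength? k λ ps → induced? ps ×-dec All.all? (_∈? A) ps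

    -- Avoidability in the subgraph induced by A, phrased inside G so that no new graph has to be
    -- built.
    ExtensionsClose : Subset n → List V → Set
    ExtensionsClose A ps = ∀ {x y} → x ∈ₛ A → y ∈ₛ A → Induced (x ∷ ps ++ [ y ]) →
      ∃ λ cs → IsInducedCycle G cs × All (_∈ₛ A) cs × All (_∈ cs) (x ∷ ps ++ [ y ])

    HasAvoidable : Subset n → Set
    HasAvoidable A = ∃ λ ps → length ps ≡ k × Induced ps × All (_∈ₛ A) ps × ExtensionsClose A ps

    CanGrow : Subset n → Subset n → V → Set
    CanGrow A U v = v ∈ₛ A × v ∉ₛ U × Touches U v × HasPath (A ∖N[ U ∪ ⁅ v ⁆ ])

    canGrow? : ∀ A U → Decidable (CanGrow A U)
    canGrow? A U v =
      (v ∈? A) ×-dec ¬? (v ∈? U) ×-dec touches? U v ×-dec hasPath? (A ∖N[ U ∪ ⁅ v ⁆ ])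

    extend : ∀ {A U ps} → Connected U → U ⊆ A → ¬ ∃ (CanGrow A U) →
             length ps ≡ k → All (_∈ₛ A ∖N[ U ]) ps →
             ExtensionsClose (A ∖N[ U ]) ps → ExtensionsClose A ps
    extend {A} {U} {ps} conn U⊆A maximal refl ps∈ close {x} {y} x∈ y∈ ind =
      cases (touches? U x) (touches? U y)
      where
      ps⊆A : All (_∈ₛ A) ps
      ps⊆A = All.map (proj₁ ∘ ∖N⁻) ps∈

      apart : ∀ {u v} → v ∈ₛ A ∖N[ U ] → u ∈ₛ U → Far u v
      apart v∈ u∈ t = proj₂ (∖N⁻ {A} v∈) (_ , u∈ , t)

      -- Otherwise the first vertex of the path, a neighbour of x, would lie in N[U].
      x∉U : x ∉ₛ U
      x∉U x∈U with All.lookupAny ps∈ (first-edge ps 1≤k ind)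
      ... | p∈ , e = apart p∈ x∈U (inj₂ e)

      y∉U : y ∉ₛ U
      y∉U y∈U with All.lookupAny ps∈ (last-edge ps 1≤k ind)
      ... | p∈ , e = apart p∈ y∈U (inj₂ (~-sym e))

      cases : Dec (Touches U x) → Dec (Touches U y) →
              ∃ λ cs → IsInducedCycle G cs × All (_∈ₛ A) cs × All (_∈ cs) (x ∷ ps ++ [ y ])
      cases (no ¬tx) (no ¬ty) with close (∖N⁺ x∈ ¬tx) (∖N⁺ y∈ ¬ty) ind
      ... | cs , cyc , cs∈ , ⊆cs = cs , cyc , All.map (proj₁ ∘ ∖N⁻) cs∈ , ⊆cs
      -- Here U could grow by x: the shifted path avoids N[U] because y does, and avoids N[x]
      -- because the extension is induced.
      cases (yes tx) (no ¬ty) with dropFirst ps 1≤k ind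
      ... | qs , len , ind′ , far , qs∈ = contradiction (x , x∈ , x∉U , tx , qs , len , ind′ ,
              All.zipWith (λ (v∈ , f) → ∖N-∪ (All.lookup (++⁺ ps∈ (∖N⁺ y∈ ¬ty ∷ [])) v∈) f)
                          (qs∈ , far)) maximal
      cases (no ¬tx) (yes ty) with dropLast ps 1≤k ind
      ... | qs , len , ind′ , far , qs∈ = contradiction (y , y∈ , y∉U , ty , qs , len , ind′ ,
              All.zipWith (λ (v∈ , f) → ∖N-∪ (All.lookup (∖N⁺ x∈ ¬tx ∷ ps∈) v∈) f)
                          (qs∈ , far)) maximal
      -- The connecting path runs inside U, to which no vertex of `ps` is adjacent, so the cycle has
      -- no chords between them.
      cases (yes tx) (yes ty) with link conn x∉U (far-ends ps 1≤k ind ∘ inj₁ ∘ sym) tx ty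
      ... | qs , ind′ , qs⊆U =
        x ∷ ps ++ y ∷ qs ,
        closeThrough ps qs 1≤k ind ind′
          (All.map (λ p∈ → All.map (λ q∈ → apart p∈ q∈ ∘ Touch-sym) qs⊆U) ps∈) ,
        x∈ ∷ ++⁺ ps⊆A (y∈ ∷ All.map U⊆A qs⊆U) ,
        here refl ∷ ++⁺ (All.tabulate (there ∘ ∈-++⁺ˡ)) (there (∈-++⁺ʳ ps (here refl)) ∷ [])

    -- U grows as long as it can, which terminates by well-foundedness of proper supersets; only for
    -- a maximal U is the induction on A invoked.
    avoidable-outside : ∀ {A U} → (∀ {B} → B ⊂ A → HasPath B → HasAvoidable B) → Acc _⊃_ U →
                        Connected U → U ⊆ A → HasPath (A ∖N[ U ]) → HasAvoidable A
    avoidable-outside {A} {U} ih (acc rec) conn U⊆A has with any? (canGrow? A U)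
    ... | yes (v , v∈A , v∉U , t , has′) =
      avoidable-outside ih (rec (p⊆p∪q _ , v , q⊆p∪q U _ (x∈⁅x⁆ v) , v∉U))
        (connected-∪ conn v∉U t) U∪v⊆A has′
      where
      U∪v⊆A : U ∪ ⁅ v ⁆ ⊆ A
      U∪v⊆A w∈ with x∈p∪q⁻ U ⁅ v ⁆ w∈
      ... | inj₁ w∈U = U⊆A w∈U
      ... | inj₂ w∈v = subst (_∈ₛ A) (sym (x∈⁅y⁆⇒x≡y v w∈v)) v∈A
    -- The hub of U is a vertex of A that gets removed, so the remaining set is strictly smaller.
    ... | no maximal with ih (∖N-⊂ (U⊆A (proj₁ (proj₂ conn))) (proj₁ (proj₂ conn))) has
    ...   | ps , len , ind , ps∈ , close =
      ps , len , ind , All.map (proj₁ ∘ ∖N⁻) ps∈ , extend conn U⊆A maximal len ps∈ close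

    avoidable : ∀ {A} → Acc _⊂_ A → HasPath A → HasAvoidable A
    avoidable {A} (acc rec) (ps , refl , ind , ps∈)
      with any? (λ u → (u ∈? A) ×-dec hasPath? (A ∖N[ ⁅ u ⁆ ]))
    ... | yes (u , u∈ , has) =
      avoidable-outside (λ B⊂A → avoidable (rec B⊂A)) (⊃-wellFounded _) (connected-⁅⁆ u)
        (λ v∈ → subst (_∈ₛ A) (sym (x∈⁅y⁆⇒x≡y u v∈)) u∈) has
    -- The given path already works: an extension would shift to a path outside N[x], so there is
    -- none.
    ... | no none = ps , refl , ind , ps∈ , λ {x} x∈ y∈ ext →
      let qs , len , ind′ , far , qs∈ = dropFirst ps 1≤k ext
      in contradiction (x , x∈ , qs , len , ind′ ,
           All.zipWith (λ (v∈ , f) → ∖N-⁅⁆ (All.lookup (++⁺ ps∈ (y∈ ∷ [])) v∈) f) (qs∈ , far))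
         none

theorem1p9 : (k : ℕ) → 1 ≤ k → (G : Graph) →
    (¬ (∃ λ (P : List (Vertex G)) → length P ≡ k × IsInducedPath G P))
    ⊎ (∃ λ (P : List (Vertex G)) → length P ≡ k × Avoidable G P)
-- With A the full vertex set, the relative notions become the absolute ones.
theorem1p9 k 1≤k G with hasPath? G 1≤k ⊤
... | no none = inj₁ λ (P , len , path) →
  none (P , len , isInducedPath⇒induced G P path , All.universal (λ _ → ∈⊤) P)
... | yes has with avoidable G 1≤k (⊂-wellFounded ⊤) has
...   | P , len , ind , _ , close =
  inj₂ (P , len , induced⇒isInducedPath G ind , λ x y ext →
    let cs , cyc , _ , ⊆cs = close ∈⊤ ∈⊤ (isInducedPath⇒induced G _ ext) in cs , cyc , ⊆cs)
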